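{- Let $G$ be a graph. Let $\tau:V(G)\to\mathbb{N}_0$ be a threshold function for $G$ with $\tau(u)\le d_G(u)$ and $\tau(u)\in\{0,1,d_G(u)\}$ for every vertex $u$ of $G$. Let $X$ be a set of vertices of $G$. Let $U$ be the vertex set of a connected component of order at least $2$ of the induced subgraph $G\big[\{u\in V(G):\tau(u)=d_G(u)\}\big]$. Let $$G'=G-N_G[U]\quad\text{and}\quad \tau'(u)=\max\big\{0,\ \tau(u)-|N_G(u)\cap N_G[U]|\big\}\ \text{ for every vertex } u \text{ of } G'.$$ Then $X$ is a non-monotone target set for $(G,\tau)$ if and only if $N_G[U]\subseteq X$ and $X\setminus N_G[U]$ is a non-monotone target set for $(G',\tau')$. Furthermore, $\tau'(u)\in\{0,1,d_{G'}(u)\}$ for every $u\in V(G')$.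
   Context: Graphs are finite, simple, and undirected. $\mathbb{N}=\{1,2,3,\ldots\}$ and $\mathbb{N}_0=\{0,1,2,\ldots\}$. $d_G(u)$ is the degree of $u$ in $G$ and $N_G(u)$ is the set of neighbors of $u$. For a set $Y$ of vertices of $G$, $N_G(Y)=\left(\bigcup_{u\in Y}N_G(u)\right)\setminus Y$ and $N_G[Y]=Y\cup N_G(Y)$. For a set $Y$ of vertices, $G-Y$ is the subgraph induced by $V(G)\setminus Y$ (possibly with no vertices). The order of a graph is its number of vertices. A threshold function for $G$ is a function $\tau:V(G)\to\mathbb{N}_0$. For $X\subseteq V(G)$, the non-monotone activation process on $(G,\tau)$ starting with $X$ is the sequence $(X_t)_{t\in\mathbb{N}_0}$ with $X_0=X$ and $X_t=\{u\in V(G):|N_G(u)\cap X_{t-1}|\ge\tau(u)\}$ for every $t\in\mathbb{N}$. The set $X$ is a non-monotone target set for $(G,\tau)$ if there is some $t_0\in\mathbb{N}_0$ such that $X_t=V(G)$ for every $t\ge t_0$. -}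

module Defs where

open import Data.Fin.Base using (Fin)
open import Data.Fin.Subset
open import Data.Fin.Subset.Properties using (_∈?_; x∈p∩q⁺)
open import Data.List.Base using (allFin; filter; map)
open import Data.Nat.Base using (ℕ; zero; suc; _∸_; _≥_)
open import Data.Nat.Properties using (_≟_; _≥?_)
open import Data.Product.Base using (∃; _×_; _,_)
open import Data.Vec.Base using (tabulate)
open import Level using (0ℓ)
open import Relation.Binary.Construct.Closure.ReflexiveTransitive using (Star)
open import Relation.Binary.Core using (Rel)
open import Relation.Binary.Definitions as B using (Symmetric)
open import Relation.Binary.PropositionalEquality.Core using (_≡_)
open import Relation.Nullary using (¬_; does)
open import Relation.Nullary.Decidable using (_×-dec_)
open import Relation.Unary using (Pred; Decidable)

private
  variable
    n : ℕ

-- { u ∈ S ∣ P u }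
sep : {P : Pred (Fin n) 0ℓ} → Subset n → Decidable P → Subset n
sep S P? = S ∩ tabulate (λ u → does (P? u))

-- A finite simple graph whose vertex set is a subset of an ambient Fin n, so
-- that a graph and its induced subgraphs share one type of potential vertices.
record Graph (n : ℕ) : Set₁ where
  field
    V      : Subset n
    Adj    : Rel (Fin n) 0ℓ
    adj?   : B.Decidable Adj
    sym    : Symmetric Adj
    irrefl : ∀ {u} → ¬ Adj u u
    adj∈V  : ∀ {u v} → Adj u v → u ∈ V

open Graph public using (V; Adj)

nbrs : Graph n → Fin n → Subset n
nbrs G u = sep (V G) (Graph.adj? G u)

deg : Graph n → Fin n → ℕ
deg G u = ∣ nbrs G u ∣

openNbhd : Graph n → Subset n → Subset n
openNbhd {n} G Y = ⋃ (map (nbrs G) (filter (_∈? Y) (allFin n))) ─ Y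

closedNbhd : Graph n → Subset n → Subset n
closedNbhd G Y = Y ∪ openNbhd G Y

induced : Graph n → Subset n → Graph n
induced G S = record
  { V      = V G ∩ S
  ; Adj    = λ u v → Adj G u v × u ∈ S × v ∈ S
  ; adj?   = λ u v → adj? u v ×-dec (u ∈? S) ×-dec (v ∈? S)
  ; sym    = λ { (uv , u∈S , v∈S) → sym uv , v∈S , u∈S }
  ; irrefl = λ { (uu , _) → irrefl uu }
  ; adj∈V  = λ { (uv , u∈S , _) → x∈p∩q⁺ (adj∈V uv , u∈S) }
  }
  where
  open Graph G using (adj?; sym; irrefl; adj∈V)

delete : Graph n → Subset n → Graph n
delete G Y = induced G (V G ─ Y)

Connected : Graph n → Set
Connected G =
  Nonempty (V G) × (∀ {u v} → u ∈ V G → v ∈ V G → Star (Adj G) u v)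

-- U is the vertex set of a maximal connected subgraph of G.
IsComponent : Graph n → Subset n → Set
IsComponent G U =
  U ⊆ V G × Connected (induced G U) ×
  (∀ W → W ⊆ V G → U ⊆ W → Connected (induced G W) → W ⊆ U)

-- Only the values on the vertices of the graph at hand are ever used.
Threshold : ℕ → Set
Threshold n = Fin n → ℕ

process : Graph n → Threshold n → Subset n → ℕ → Subset n
process G τ X zero    = X
process G τ X (suc t) =
  sep (V G) (λ u → ∣ nbrs G u ∩ process G τ X t ∣ ≥? τ u)

IsTargetSet : Graph n → Threshold n → Subset n → Set
IsTargetSet G τ X = ∃ λ t₀ → ∀ t → t ≥ t₀ → process G τ X t ≡ V G

fullThreshold : Graph n → Threshold n → Subset n
fullThreshold G τ = sep (V G) (λ u → τ u ≟ deg G u)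

-- Truncated subtraction is max {0, τ u − ∣ N(u) ∩ Y ∣}.
reduce : Graph n → Threshold n → Subset n → Threshold n
reduce G τ Y u = τ u ∸ ∣ nbrs G u ∩ Y ∣

{-# OPTIONS --safe #-}

-- A vertex u with τ u = d(u) is active at time t + 1 only if all its neighbours
-- are active at time t.  Every vertex of N[U] has a neighbour in U, so N[U] ⊆ X_{t+1}
-- forces N[U] ⊆ X_t.  Conversely N[U] ⊆ X_t gives N[U] ⊆ X_{t+1}: a vertex of N(U) is not
-- of full threshold because U is a component, so one active neighbour activates it.
-- Hence in both directions N[U] is active at all times, and then the processes on
-- (G, τ) and (G′, τ′) agree outside N[U].

module Submission where

open import Defs
open import Data.Fin.Base using (Fin)
open import Data.Fin.Properties using (any?)
open import Data.Fin.Subset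
  using (Subset; inside; outside; _∈_; _∉_; _⊆_; _∩_; _∪_; _─_; ⋃; ⁅_⁆; ∣_∣)
open import Data.Fin.Subset.Properties
  using ( _∈?_; x∈p∩q⁺; x∈p∩q⁻; x∈p∪q⁺; x∈p∪q⁻; p∩q⊆p; p∩q⊆q; p⊆p∪q; p─q⊆p
        ; x∈p∧x∉q⇒x∈p─q; x∈⁅x⁆; x∈⁅y⁆⇒x≡y; ∣⁅x⁆∣≡1; ∉⊥; ⊆-antisym; ⊆-reflexive
        ; p⊆q⇒∣p∣≤∣q∣; p⊂q⇒∣p∣<∣q∣ )
open import Data.List.Base using (List; []; _∷_; allFin; filter; map)
open import Data.List.Membership.Propositional as List using ()
open import Data.List.Membership.Propositional.Properties
  using (∈-allFin; ∈-filter⁺; ∈-filter⁻; ∈-map⁺; ∈-map⁻)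
open import Data.List.Relation.Unary.Any using (here; there)
open import Data.Nat.Base using (ℕ; zero; suc; _+_; _∸_; _≤_; _≥_; z≤n; s≤s)
open import Data.Nat.Properties
  using ( _≟_; _≥?_; ≤-refl; ≤-reflexive; ≤-trans; <⇒≱; +-suc; +-monoʳ-≤; m≤n+m∸n
        ; m≤n+o⇒m∸n≤o; 0∸n≡0; m+n∸m≡n )
open import Data.Product.Base using (∃; _×_; _,_; proj₁; proj₂)
open import Data.Sum.Base using (_⊎_; inj₁; inj₂)
open import Data.Vec.Base using ([]; _∷_; here; there)
open import Data.Vec.Properties using ([]=⇒lookup; lookup⇒[]=; lookup∘tabulate)
open import Function.Bundles using (_⇔_; mk⇔; module Equivalence)
open import Level using (0ℓ)
open import Relation.Binary.Construct.Closure.ReflexiveTransitive as Star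
  using (Star; ε; _◅_; _◅◅_)
open import Relation.Binary.PropositionalEquality
  using (_≡_; refl; sym; trans; cong; cong₂; subst; module ≡-Reasoning)
open import Relation.Nullary using (yes; no; does; contradiction)
open import Relation.Nullary.Decidable using (_×-dec_; dec-true)
open import Relation.Unary using (Pred; Decidable)

private
  variable
    n : ℕ
    u v w x : Fin n
    p q Y : Subset n

-- Finite subsets: differences, cardinalities, unions and separation.

x∈p─q⇒x∉q : (p q : Subset n) → x ∈ p ─ q → x ∉ q
x∈p─q⇒x∉q (inside ∷ _)  (outside ∷ _) here         ()
x∈p─q⇒x∉q (_ ∷ p)       (_ ∷ q)       (there x∈─) (there x∈q) = x∈p─q⇒x∉q p q x∈─ x∈q

∣p∩q∣+∣p─q∣≡∣p∣ : (p q : Subset n) → ∣ p ∩ q ∣ + ∣ p ─ q ∣ ≡ ∣ p ∣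
∣p∩q∣+∣p─q∣≡∣p∣ [] [] = refl
∣p∩q∣+∣p─q∣≡∣p∣ (inside  ∷ p) (inside  ∷ q) = cong suc (∣p∩q∣+∣p─q∣≡∣p∣ p q)
∣p∩q∣+∣p─q∣≡∣p∣ (inside  ∷ p) (outside ∷ q) =
  trans (+-suc ∣ p ∩ q ∣ ∣ p ─ q ∣) (cong suc (∣p∩q∣+∣p─q∣≡∣p∣ p q))
∣p∩q∣+∣p─q∣≡∣p∣ (outside ∷ p) (inside  ∷ q) = ∣p∩q∣+∣p─q∣≡∣p∣ p q
∣p∩q∣+∣p─q∣≡∣p∣ (outside ∷ p) (outside ∷ q) = ∣p∩q∣+∣p─q∣≡∣p∣ p q

x∈p⇒1≤∣p∣ : x ∈ p → 1 ≤ ∣ p ∣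
x∈p⇒1≤∣p∣ {x = x} {p = p} x∈p = subst (_≤ ∣ p ∣) (∣⁅x⁆∣≡1 x)
  (p⊆q⇒∣p∣≤∣q∣ λ y∈ → subst (_∈ p) (sym (x∈⁅y⁆⇒x≡y x y∈)) x∈p)

-- An element of `p` outside `q` would make `p ∩ q` a proper subset of `p`, hence strictly smaller.
-- With `p = nbrs G u` this turns a threshold equal to the degree into the activity of every
-- neighbour.
∣p∣≤∣p∩q∣⇒p⊆q : ∣ p ∣ ≤ ∣ p ∩ q ∣ → p ⊆ q
∣p∣≤∣p∩q∣⇒p⊆q {p = p} {q = q} le {x} x∈p with x ∈? q
... | yes x∈q = x∈q
... | no  x∉q = contradiction le
  (<⇒≱ (p⊂q⇒∣p∣<∣q∣ (p∩q⊆p p q , x , x∈p , λ x∈ → x∉q (p∩q⊆q p q x∈))))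

x∈⋃⁺ : {ps : List (Subset n)} → p List.∈ ps → x ∈ p → x ∈ ⋃ ps
x∈⋃⁺ (here refl)  x∈p = x∈p∪q⁺ (inj₁ x∈p)
x∈⋃⁺ (there p∈ps) x∈p = x∈p∪q⁺ (inj₂ (x∈⋃⁺ p∈ps x∈p))

x∈⋃⁻ : (ps : List (Subset n)) → x ∈ ⋃ ps → ∃ λ p → p List.∈ ps × x ∈ p
x∈⋃⁻ []       x∈ = contradiction x∈ ∉⊥
x∈⋃⁻ (p ∷ ps) x∈ with x∈p∪q⁻ p (⋃ ps) x∈
... | inj₁ x∈p = p , here refl , x∈p
... | inj₂ x∈⋃ with q , q∈ , x∈q ← x∈⋃⁻ ps x∈⋃ = q , there q∈ , x∈q

module _ {P : Pred (Fin n) 0ℓ} (P? : Decidable P) where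

  ∈-sep⁺ : x ∈ p → P x → x ∈ sep p P?
  ∈-sep⁺ {x = x} x∈p px = x∈p∩q⁺ (x∈p ,
    lookup⇒[]= x _ (trans (lookup∘tabulate _ x) (dec-true (P? x) px)))

  ∈-sep⁻ : x ∈ sep p P? → x ∈ p × P x
  ∈-sep⁻ {x = x} {p = p} x∈ with x∈p , x∈tab ← x∈p∩q⁻ p _ x∈
    with P? x | trans (sym (lookup∘tabulate (λ u → does (P? u)) x)) ([]=⇒lookup x∈tab)
  ... | yes px | _  = x∈p , px
  ... | no  _  | ()

-- Neighbourhoods and the deletion of a vertex set.

module _ (G : Graph n) where
  open Graph G using (adj?; adj∈V) renaming (sym to adj-sym)

  ∈-nbrs⁺ : Adj G u v → v ∈ nbrs G u
  ∈-nbrs⁺ {u = u} uv = ∈-sep⁺ (adj? u) (adj∈V (adj-sym uv)) uv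

  ∈-nbrs⁻ : v ∈ nbrs G u → Adj G u v
  ∈-nbrs⁻ {u = u} v∈ = proj₂ (∈-sep⁻ (adj? u) v∈)

  ∈-closedNbhd⁺ : u ∈ Y → Adj G u v → v ∈ closedNbhd G Y
  ∈-closedNbhd⁺ {u = u} {Y = Y} {v = v} u∈Y uv with v ∈? Y
  ... | yes v∈Y = x∈p∪q⁺ (inj₁ v∈Y)
  ... | no  v∉Y = x∈p∪q⁺ (inj₂ (x∈p∧x∉q⇒x∈p─q
    (x∈⋃⁺ (∈-map⁺ (nbrs G) (∈-filter⁺ (_∈? Y) (∈-allFin u) u∈Y)) (∈-nbrs⁺ uv)) v∉Y))

  ∈-closedNbhd⁻ : v ∈ closedNbhd G Y → v ∈ Y ⊎ (∃ λ u → u ∈ Y × Adj G u v)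
  ∈-closedNbhd⁻ {Y = Y} v∈ with x∈p∪q⁻ Y (openNbhd G Y) v∈
  ... | inj₁ v∈Y = inj₁ v∈Y
  ... | inj₂ v∈N
    with _ , p∈ , v∈p ← x∈⋃⁻ (map (nbrs G) (filter (_∈? Y) (allFin n))) (p─q⊆p _ Y v∈N)
    with u , u∈ , refl ← ∈-map⁻ (nbrs G) p∈
    = inj₂ (u , proj₂ (∈-filter⁻ (_∈? Y) {xs = allFin n} u∈) , ∈-nbrs⁻ v∈p)

  V-delete : (Y : Subset n) → V (delete G Y) ≡ V G ─ Y
  V-delete Y = ⊆-antisym (p∩q⊆q (V G) (V G ─ Y)) λ x∈ → x∈p∩q⁺ (p─q⊆p (V G) Y x∈ , x∈)

  nbrs-delete : u ∈ V G ─ Y → nbrs (delete G Y) u ≡ nbrs G u ─ Y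
  nbrs-delete {u = u} {Y = Y} u∈ = ⊆-antisym
    (λ v∈ → let uv , _ , v∈─ = proj₂ (∈-sep⁻ (Graph.adj? (delete G Y) u) v∈)
            in x∈p∧x∉q⇒x∈p─q (∈-nbrs⁺ uv) (x∈p─q⇒x∉q (V G) Y v∈─))
    (λ v∈ → let uv  = ∈-nbrs⁻ (p─q⊆p (nbrs G u) Y v∈)
                v∈V = adj∈V (adj-sym uv)
                v∈─ = x∈p∧x∉q⇒x∈p─q v∈V (x∈p─q⇒x∉q (nbrs G u) Y v∈)
            in ∈-sep⁺ (Graph.adj? (delete G Y) u) (x∈p∩q⁺ (v∈V , v∈─)) (uv , u∈ , v∈─))

  deg-delete : u ∈ V G ─ Y → ∣ nbrs G u ∩ Y ∣ + deg (delete G Y) u ≡ deg G u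
  deg-delete {u = u} {Y = Y} u∈ = trans
    (cong (λ z → ∣ nbrs G u ∩ Y ∣ + ∣ z ∣) (nbrs-delete u∈)) (∣p∩q∣+∣p─q∣≡∣p∣ (nbrs G u) Y)

  -- The neighbours of `u` in `Z` split along `Y`: since `Y ⊆ Z`, those inside `Y` are all of
  -- `nbrs G u ∩ Y`, and those outside survive the deletion.
  ∣nbrs∩∣-delete : {Z : Subset n} → u ∈ V G ─ Y → Y ⊆ Z →
    ∣ nbrs G u ∩ Z ∣ ≡ ∣ nbrs G u ∩ Y ∣ + ∣ nbrs (delete G Y) u ∩ (Z ─ Y) ∣
  ∣nbrs∩∣-delete {u = u} {Y = Y} {Z = Z} u∈ Y⊆Z = begin
    ∣ N ∩ Z ∣
      ≡⟨ ∣p∩q∣+∣p─q∣≡∣p∣ (N ∩ Z) Y ⟨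
    ∣ (N ∩ Z) ∩ Y ∣ + ∣ N ∩ Z ─ Y ∣
      ≡⟨ cong₂ (λ a b → ∣ a ∣ + ∣ b ∣) inY outY ⟩
    ∣ N ∩ Y ∣ + ∣ (N ─ Y) ∩ (Z ─ Y) ∣
      ≡⟨ cong (λ a → ∣ N ∩ Y ∣ + ∣ a ∩ (Z ─ Y) ∣) (nbrs-delete u∈) ⟨
    ∣ N ∩ Y ∣ + ∣ nbrs (delete G Y) u ∩ (Z ─ Y) ∣
      ∎
    where
    open ≡-Reasoning
    N = nbrs G u
    inY : (N ∩ Z) ∩ Y ≡ N ∩ Y
    inY = ⊆-antisym
      (λ x∈ → let x∈NZ , x∈Y = x∈p∩q⁻ (N ∩ Z) Y x∈ in x∈p∩q⁺ (p∩q⊆p N Z x∈NZ , x∈Y))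
      (λ x∈ → let x∈N , x∈Y = x∈p∩q⁻ N Y x∈ in x∈p∩q⁺ (x∈p∩q⁺ (x∈N , Y⊆Z x∈Y) , x∈Y))
    outY : N ∩ Z ─ Y ≡ (N ─ Y) ∩ (Z ─ Y)
    outY = ⊆-antisym
      (λ x∈ → let x∈N , x∈Z = x∈p∩q⁻ N Z (p─q⊆p (N ∩ Z) Y x∈)
                  x∉Y = x∈p─q⇒x∉q (N ∩ Z) Y x∈
              in x∈p∩q⁺ (x∈p∧x∉q⇒x∈p─q x∈N x∉Y , x∈p∧x∉q⇒x∈p─q x∈Z x∉Y))
      (λ x∈ → let x∈N─Y , x∈Z─Y = x∈p∩q⁻ (N ─ Y) (Z ─ Y) x∈
              in x∈p∧x∉q⇒x∈p─q (x∈p∩q⁺ (p─q⊆p N Y x∈N─Y , p─q⊆p Z Y x∈Z─Y))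
                               (x∈p─q⇒x∉q N Y x∈N─Y))

  -- Connected components.

  connected-∪⁅⁆ : {U : Subset n} → Connected (induced G U) → u ∈ U → Adj G u w →
    Connected (induced G (U ∪ ⁅ w ⁆))
  connected-∪⁅⁆ {u = u} {w = w} {U = U} (_ , path) u∈U uw =
    (u , x∈p∩q⁺ (adj∈V uw , u∈W)) ,
    -- Every vertex is reached from `u`, so two of them are joined by a path through `u`.
    λ x∈ y∈ → Star.reverse (Graph.sym (induced G W)) (from-u x∈) ◅◅ from-u y∈
    where
    W = U ∪ ⁅ w ⁆
    U⊆W : U ⊆ W
    U⊆W = p⊆p∪q ⁅ w ⁆
    u∈W = U⊆W u∈U
    from-u : x ∈ V G ∩ W → Star (Adj (induced G W)) u x
    from-u x∈ with x∈V , x∈W ← x∈p∩q⁻ (V G) W x∈ with x∈p∪q⁻ U ⁅ w ⁆ x∈W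
    ... | inj₁ x∈U = Star.map (λ (ab , a∈ , b∈) → ab , U⊆W a∈ , U⊆W b∈)
                       (path (x∈p∩q⁺ (adj∈V uw , u∈U)) (x∈p∩q⁺ (x∈V , x∈U)))
    ... | inj₂ x∈w with refl ← x∈⁅y⁆⇒x≡y w x∈w = (uw , u∈W , x∈W) ◅ ε

  -- Attaching `w` to `U` along the edge from `u` keeps the set connected, so maximality of `U`
  -- already contains `w`.
  component-closed : {U : Subset n} → IsComponent G U → u ∈ U → Adj G u w → w ∈ U
  component-closed {w = w} {U = U} (U⊆V , conn , maximal) u∈U uw =
    maximal (U ∪ ⁅ w ⁆) W⊆V (p⊆p∪q ⁅ w ⁆) (connected-∪⁅⁆ conn u∈U uw)
      (x∈p∪q⁺ (inj₂ (x∈⁅x⁆ w)))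
    where
    W⊆V : U ∪ ⁅ w ⁆ ⊆ V G
    W⊆V x∈ with x∈p∪q⁻ U ⁅ w ⁆ x∈
    ... | inj₁ x∈U = U⊆V x∈U
    ... | inj₂ x∈w with refl ← x∈⁅y⁆⇒x≡y w x∈w = adj∈V (adj-sym uw)

  -- If `v` had no neighbour in `U`, no path inside `U` could take a first step from `v`.
  -- Connectedness would then leave `v` as the only vertex of `U`, against its order.
  component⇒neighbour : {U : Subset n} → IsComponent G U → 2 ≤ ∣ U ∣ → v ∈ U →
    ∃ λ u → u ∈ U × Adj G u v
  component⇒neighbour {v = v} {U = U} (U⊆V , (_ , path) , _) 2≤∣U∣ v∈U
    with any? (λ u → (u ∈? U) ×-dec adj? u v)
  ... | yes uv = uv
  ... | no ¬uv = contradiction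
    (≤-trans 2≤∣U∣ (≤-trans (p⊆q⇒∣p∣≤∣q∣ U⊆⁅v⁆) (≤-reflexive (∣⁅x⁆∣≡1 v)))) λ { (s≤s ()) }
    where
    trivial : Star (Adj (induced G U)) v w → w ∈ ⁅ v ⁆
    trivial ε                   = x∈⁅x⁆ v
    trivial ((vu , _ , u∈U) ◅ _) = contradiction (_ , u∈U , adj-sym vu) ¬uv
    U⊆⁅v⁆ : U ⊆ ⁅ v ⁆
    U⊆⁅v⁆ w∈U = trivial (path (x∈p∩q⁺ (U⊆V v∈U , v∈U)) (x∈p∩q⁺ (U⊆V w∈U , w∈U)))

-- The process after deletion of a set that is active at all times.

module _ (G : Graph n) (τ : Threshold n) (X : Subset n) where

  private
    X[_] : ℕ → Subset n
    X[_] = process G τ X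

  active? : ∀ t → Decidable (λ u → ∣ nbrs G u ∩ X[ t ] ∣ ≥ τ u)
  active? t u = ∣ nbrs G u ∩ X[ t ] ∣ ≥? τ u

  process⊆V : X ⊆ V G → ∀ t → X[ t ] ⊆ V G
  process⊆V X⊆V zero    = X⊆V
  process⊆V X⊆V (suc t) x∈ = proj₁ (∈-sep⁻ (active? t) x∈)

  -- Being always active, `Y` contributes the constant `∣ nbrs G u ∩ Y ∣` to the count at `u`, which
  -- is exactly the amount that `reduce` takes off the threshold.
  process-delete : (∀ t → Y ⊆ X[ t ]) → ∀ t →
    process (delete G Y) (reduce G τ Y) (X ─ Y) t ≡ X[ t ] ─ Y
  process-delete         Y⊆ zero    = refl
  process-delete {Y = Y} Y⊆ (suc t) = ⊆-antisym to from
    where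
    X′ = process (delete G Y) (reduce G τ Y) (X ─ Y)
    active′? : Decidable (λ u → ∣ nbrs (delete G Y) u ∩ X′ t ∣ ≥ reduce G τ Y u)
    active′? u = ∣ nbrs (delete G Y) u ∩ X′ t ∣ ≥? reduce G τ Y u
    count : u ∈ V G ─ Y →
      ∣ nbrs G u ∩ X[ t ] ∣ ≡ ∣ nbrs G u ∩ Y ∣ + ∣ nbrs (delete G Y) u ∩ X′ t ∣
    -- The induction hypothesis identifies `X′ t` with `X[ t ] ─ Y`.
    count u∈ rewrite process-delete {Y = Y} Y⊆ t = ∣nbrs∩∣-delete G u∈ (Y⊆ t)
    to : X′ (suc t) ⊆ X[ suc t ] ─ Y
    to {u} u∈ with u∈V′ , act ← ∈-sep⁻ active′? u∈ =
      x∈p∧x∉q⇒x∈p─q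
        (∈-sep⁺ (active? t) (p─q⊆p (V G) Y u∈─)
          -- Truncation does no harm: `τ u ≤ a + (τ u ∸ a)` holds even when `a` exceeds `τ u`.
          (subst (τ u ≤_) (sym (count u∈─))
            (≤-trans (m≤n+m∸n (τ u) a) (+-monoʳ-≤ a act))))
        (x∈p─q⇒x∉q (V G) Y u∈─)
      where
      a   = ∣ nbrs G u ∩ Y ∣
      u∈─ = ⊆-reflexive (V-delete G Y) u∈V′
    from : X[ suc t ] ─ Y ⊆ X′ (suc t)
    from {u} u∈ with u∈V , act ← ∈-sep⁻ (active? t) (p─q⊆p X[ suc t ] Y u∈) =
      ∈-sep⁺ active′? (x∈p∩q⁺ (u∈V , u∈─))
        (m≤n+o⇒m∸n≤o (τ u) ∣ nbrs G u ∩ Y ∣ (subst (τ u ≤_) (count u∈─) act))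
      where
      u∈─ = x∈p∧x∉q⇒x∈p─q u∈V (x∈p─q⇒x∉q X[ suc t ] Y u∈)

  target-delete⇔ : X ⊆ V G → (∀ t → Y ⊆ X[ t ]) →
    IsTargetSet G τ X ⇔ IsTargetSet (delete G Y) (reduce G τ Y) (X ─ Y)
  target-delete⇔ {Y = Y} X⊆V Y⊆ = mk⇔
    (λ (t₀ , h) → t₀ , λ t t≥ → trans (process-delete Y⊆ t)
      (trans (cong (_─ Y) (h t t≥)) (sym (V-delete G Y))))
    (λ (t₀ , h) → t₀ , λ t t≥ → ⊆-antisym (process⊆V X⊆V t)
      (V⊆ t (trans (sym (process-delete Y⊆ t)) (trans (h t t≥) (V-delete G Y)))))
    where
    -- Outside `Y` the equation decides; on `Y` all vertices are active anyway.
    V⊆ : ∀ t → X[ t ] ─ Y ≡ V G ─ Y → V G ⊆ X[ t ]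
    V⊆ t eq {v} v∈ with v ∈? Y
    ... | yes v∈Y = Y⊆ t v∈Y
    ... | no  v∉Y = p─q⊆p X[ t ] Y (⊆-reflexive (sym eq) (x∈p∧x∉q⇒x∈p─q v∈ v∉Y))

-- Persistence of `N[U]` for a component `U` of the full-threshold vertices.

module _ (G : Graph n) (τ : Threshold n) where

  private
    F = fullThreshold G τ
    H = induced G F

  ∈-fullThreshold⁻ : u ∈ F → τ u ≡ deg G u
  ∈-fullThreshold⁻ u∈F = proj₂ (∈-sep⁻ (λ u → τ u ≟ deg G u) u∈F)

  module _ {U : Subset n} (comp : IsComponent H U) (2≤∣U∣ : 2 ≤ ∣ U ∣) (X : Subset n) where

    private
      N[U] = closedNbhd G U
      X[_] = process G τ X

      U⊆V : U ⊆ V G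
      U⊆V u∈ = p∩q⊆p (V G) F (proj₁ comp u∈)

      U-full : u ∈ U → τ u ≡ deg G u
      U-full u∈ = ∈-fullThreshold⁻ (p∩q⊆q (V G) F (proj₁ comp u∈))

    -- For `v` in `U` itself the order of at least 2 supplies the neighbour, so `U` and its outer
    -- neighbours can be treated alike below.
    neighbour-in-U : v ∈ N[U] → ∃ λ u → u ∈ U × Adj G u v
    neighbour-in-U v∈ with ∈-closedNbhd⁻ G v∈
    ... | inj₂ uv  = uv
    ... | inj₁ v∈U with u , u∈U , uv , _ ← component⇒neighbour H comp 2≤∣U∣ v∈U = u , u∈U , uv

    N[U]⊆V : N[U] ⊆ V G
    N[U]⊆V v∈ with _ , _ , uv ← neighbour-in-U v∈ = Graph.adj∈V G (Graph.sym G uv)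

    N[U]-backward : ∀ t → N[U] ⊆ X[ suc t ] → N[U] ⊆ X[ t ]
    N[U]-backward t N⊆ v∈ with u , u∈U , uv ← neighbour-in-U v∈ =
      -- The active vertex `u` has threshold `deg G u`, so all its neighbours, `v` among them, were
      -- active one step before.
      ∣p∣≤∣p∩q∣⇒p⊆q {p = nbrs G u} 
        (≤-trans (≤-reflexive (sym (U-full u∈U))) (proj₂ (∈-sep⁻ (active? G τ X t) u∈X)))
        (∈-nbrs⁺ G uv)
      where
      u∈X : u ∈ X[ suc t ]
      u∈X = N⊆ (x∈p∪q⁺ (inj₁ u∈U))

    N[U]⊆X : ∀ t → N[U] ⊆ X[ t ] → N[U] ⊆ X
    N[U]⊆X zero    N⊆ = N⊆
    N[U]⊆X (suc t) N⊆ = N[U]⊆X t (N[U]-backward t N⊆)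

    module _ (τ-values : ∀ u → u ∈ V G → τ u ≡ 0 ⊎ τ u ≡ 1 ⊎ τ u ≡ deg G u) where

      N[U]-forward : ∀ t → N[U] ⊆ X[ t ] → N[U] ⊆ X[ suc t ]
      N[U]-forward t N⊆ {v} v∈ = ∈-sep⁺ (active? G τ X t) v∈V act
        where
        v∈V = N[U]⊆V v∈
        act-U : v ∈ U → τ v ≤ ∣ nbrs G v ∩ X[ t ] ∣
        act-U v∈U = ≤-trans (≤-reflexive (U-full v∈U)) (p⊆q⇒∣p∣≤∣q∣ λ w∈ →
          x∈p∩q⁺ (w∈ , N⊆ (∈-closedNbhd⁺ G v∈U (∈-nbrs⁻ G w∈))))
        act : τ v ≤ ∣ nbrs G v ∩ X[ t ] ∣
        act with u , u∈U , uv ← neighbour-in-U v∈ with τ-values v v∈V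
        ... | inj₁ τ≡0        = ≤-trans (≤-reflexive τ≡0) z≤n
        ... | inj₂ (inj₁ τ≡1) = ≤-trans (≤-reflexive τ≡1)
          (x∈p⇒1≤∣p∣ (x∈p∩q⁺ (∈-nbrs⁺ G (Graph.sym G uv) , N⊆ (x∈p∪q⁺ (inj₁ u∈U)))))
        -- A vertex of full threshold adjacent to `u` lies in the component `U`, so its whole
        -- neighbourhood is within `N[U]` and hence active.
        ... | inj₂ (inj₂ τ≡d) = act-U (component-closed H comp u∈U
          (uv , p∩q⊆q (V G) F (proj₁ comp u∈U) , ∈-sep⁺ (λ u → τ u ≟ deg G u) v∈V τ≡d))

      N[U]⊆process : N[U] ⊆ X → ∀ t → N[U] ⊆ X[ t ]
      N[U]⊆process N⊆ zero    = N⊆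
      N[U]⊆process N⊆ (suc t) = N[U]-forward t (N[U]⊆process N⊆ t)

  -- Threshold 1 drops to 0 once `u` has a neighbour in `Y`, and a full threshold stays full because
  -- threshold and degree both lose `∣ nbrs G u ∩ Y ∣`.
  reduce-values : u ∈ V (delete G Y) → τ u ≡ 0 ⊎ τ u ≡ 1 ⊎ τ u ≡ deg G u →
    reduce G τ Y u ≡ 0 ⊎ reduce G τ Y u ≡ 1 ⊎ reduce G τ Y u ≡ deg (delete G Y) u
  reduce-values {u = u} {Y = Y} u∈ (inj₁ τ≡0) =
    inj₁ (trans (cong (_∸ ∣ nbrs G u ∩ Y ∣) τ≡0) (0∸n≡0 ∣ nbrs G u ∩ Y ∣))
  reduce-values {u = u} {Y = Y} u∈ (inj₂ (inj₁ τ≡1)) with ∣ nbrs G u ∩ Y ∣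
  ... | zero  = inj₂ (inj₁ τ≡1)
  ... | suc b = inj₁ (trans (cong (_∸ suc b) τ≡1) (0∸n≡0 b))
  reduce-values {u = u} {Y = Y} u∈ (inj₂ (inj₂ τ≡d)) = inj₂ (inj₂ (begin
    τ u ∸ a          ≡⟨ cong (_∸ a) τ≡d ⟩
    deg G u ∸ a      ≡⟨ cong (_∸ a) (deg-delete G (⊆-reflexive (V-delete G Y) u∈)) ⟨
    a + d′ ∸ a       ≡⟨ m+n∸m≡n a d′ ⟩
    d′               ∎))
    where
    open ≡-Reasoning
    a  = ∣ nbrs G u ∩ Y ∣
    d′ = deg (delete G Y) u

lemma1 : (n : ℕ) (G : Graph n) (τ : Threshold n) →
  (∀ u → u ∈ V G → τ u ≤ deg G u) →
  (∀ u → u ∈ V G → τ u ≡ 0 ⊎ τ u ≡ 1 ⊎ τ u ≡ deg G u) →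
  (X : Subset n) → X ⊆ V G →
  (U : Subset n) → IsComponent (induced G (fullThreshold G τ)) U → 2 ≤ ∣ U ∣ →
  let N[U] = closedNbhd G U
      G′   = delete G N[U]
      τ′   = reduce G τ N[U]
  in (IsTargetSet G τ X ⇔ (N[U] ⊆ X × IsTargetSet G′ τ′ (X ─ N[U])))
     × (∀ u → u ∈ V G′ → τ′ u ≡ 0 ⊎ τ′ u ≡ 1 ⊎ τ′ u ≡ deg G′ u)
lemma1 n G τ _ τ-values X X⊆V U comp 2≤∣U∣ =
  mk⇔
    (λ (t₀ , h) →
      -- At time `t₀` all vertices are active, `N[U]` included; stepping backward reaches time 0,
      -- where the active set is `X`.
      let N⊆X = N[U]⊆X G τ comp 2≤∣U∣ X t₀
                  (λ v∈ → ⊆-reflexive (sym (h t₀ ≤-refl)) (N[U]⊆V G τ comp 2≤∣U∣ X v∈))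
      in (λ {_} → N⊆X) , Equivalence.to (equiv N⊆X) (t₀ , h))
    (λ (N⊆X , target) → Equivalence.from (equiv N⊆X) target)
  , λ u u∈ → reduce-values G τ u∈ (τ-values u (p∩q⊆p (V G) _ u∈))
  where
  equiv : closedNbhd G U ⊆ X → _
  equiv N⊆X = target-delete⇔ G τ X X⊆V (N[U]⊆process G τ comp 2≤∣U∣ X τ-values N⊆X)
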